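{- Let $M$ be a transversal matroid and $e\in E(M)$. Let $\mathcal A=(A_1,\ldots,A_r)$ be a presentation of $M$ with $r=r(M)$, such that for some $k$, $e\in A_i$ for all $i\le k$ and $e\notin A_j$ for all $j>k$. Let $G$ be a minimal $(e,\mathcal A)$-presenting graph which is a tree, and let $\phi$ be an $(e,\mathcal A)$-presenting map of $G$. Suppose $E(G)=\{\{u_1,v_1\},\{u_2,v_2\},\ldots,\{u_{k-1},v_{k-1}\}\}$. Then $$(A_{\phi(u_1)}\cup A_{\phi(v_1)}-e,\ \ldots,\ A_{\phi(u_{k-1})}\cup A_{\phi(v_{k-1})}-e,\ A_{k+1},A_{k+2},\ldots,A_r)$$ is a presentation of $M/e$.
   Context: A presentation $\mathcal A=(A_1,\ldots,A_r)$ (a sequence of not necessarily distinct subsets of $E$) of a transversal matroid $M=M[\mathcal A]$ means the independent sets of $M$ are exactly the partial transversals of $\mathcal A$, i.e. sets $\{x_1,\ldots,x_m\}$ of distinct elements with distinct indices $k_1,\ldots,k_m\in[r]$ and $x_i\in A_{k_i}$. Write $\mathrm{cl}^*_M$ for the closure operator of the dual matroid $M^*$. A graph $G$ is an $(e,\mathcal A)$-presenting graph if there is a bijection $\phi:V(G)\to\{i\in[r]: e\in A_i\}$ such that for all distinct $v_1,v_2\in V(G)$, the subgraph of $G$ induced by $\{u\in V(G): A_{\phi(u)}\subseteq \mathrm{cl}^*_M(A_{\phi(v_1)}\cup A_{\phi(v_2)})\}$ is connected; $\phi$ is then an $(e,\mathcal A)$-presenting map of $G$. $G$ is a minimal $(e,\mathcal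 A)$-presenting graph if it is $(e,\mathcal A)$-presenting and deleting any single edge gives a graph that is not $(e,\mathcal A)$-presenting. -}

module Defs where

open import Data.Fin.Base using (Fin; zero; suc; inject₁; fromℕ)
open import Data.Fin.Subset using (Subset; _∈_; _∉_; _⊆_; _∪_; _─_; ⁅_⁆; ∣_∣; ⊥)
open import Data.Nat.Base using (ℕ; _+_; _≤_; _<_)
open import Data.Sum.Base using (_⊎_; inj₁; inj₂)
open import Data.Vec.Functional using (Vector)
open import Data.Product.Base using (∃; ∃₂; _×_; _,_)
open import Function.Bundles using (_⇔_)
open import Function.Definitions using (Injective)
open import Level using (0ℓ)
open import Relation.Binary.Core using (Rel)
open import Relation.Binary.Construct.Closure.ReflexiveTransitive using (Star)
open import Relation.Binary.Definitions using (Decidable; Symmetric; Irreflexive)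
open import Relation.Binary.PropositionalEquality.Core using (_≡_; _≢_)
open import Relation.Nullary using (¬_; ¬?; _×-dec_; _⊎-dec_)
open import Relation.Unary using (Pred; U)
import Data.Fin.Properties as Fin

private
  variable
    n r v : ℕ

-- The ground set is a subset of an ambient Fin n, so that M and M / e
-- live over the same type of elements.
record SetSystem (n : ℕ) : Set₁ where
  field
    ground : Subset n
    Indep  : Pred (Subset n) 0ℓ

open SetSystem public

record IsMatroid (M : SetSystem n) : Set where
  field
    indep⊆ground : ∀ {I} → Indep M I → I ⊆ ground M
    ∅-indep      : Indep M ⊥
    hereditary   : ∀ {I J} → J ⊆ I → Indep M I → Indep M J
    augmentation : ∀ {I J} → Indep M I → Indep M J → ∣ I ∣ < ∣ J ∣ →
                   ∃ λ x → x ∈ J × x ∉ I × Indep M (I ∪ ⁅ x ⁆)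

IsBasisOf : SetSystem n → Subset n → Subset n → Set
IsBasisOf M X B =
  B ⊆ X × Indep M B × (∀ I → I ⊆ X → Indep M I → B ⊆ I → I ⊆ B)

IsBasis : SetSystem n → Subset n → Set
IsBasis M B = IsBasisOf M (ground M) B

-- HasRank M X k: the largest independent subsets of X have k elements.
HasRank : SetSystem n → Subset n → ℕ → Set
HasRank M X k = (∃ λ I → I ⊆ X × Indep M I × ∣ I ∣ ≡ k)
              × (∀ I → I ⊆ X → Indep M I → ∣ I ∣ ≤ k)

-- cl(X) = { x ∈ E : r(X ∪ x) = r(X) }
cl : SetSystem n → Subset n → Pred (Fin n) 0ℓ
cl M X x = x ∈ ground M × ∃ λ k → HasRank M X k × HasRank M (X ∪ ⁅ x ⁆) k

-- The bases of M * are the complements of the bases of M; its independent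
-- sets are the subsets of those.
infix 9 _*
_* : SetSystem n → SetSystem n
M * = record
  { ground = ground M
  ; Indep  = λ X → ∃ λ B → IsBasis M B × X ⊆ (ground M ─ B)
  }

-- X is independent in M / T iff X ∪ B is independent in M for some basis
-- B of T; for a loop e this makes M / ⁅ e ⁆ the deletion of e.
infixl 8 _/_
_/_ : SetSystem n → Subset n → SetSystem n
M / T = record
  { ground = ground M ─ T
  ; Indep  = λ X → X ⊆ (ground M ─ T)
                 × ∃ λ B → IsBasisOf M T B × Indep M (X ∪ B)
  }

-- X = { x 0 , … , x (m - 1) } with x i ∈ A (κ i).
IsPartialTransversal : Vector (Subset n) r → Subset n → Set
IsPartialTransversal {n} {r} A X =
  ∃ λ m → ∃₂ λ (x : Fin m → Fin n) (κ : Fin m → Fin r) →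
    Injective _≡_ _≡_ x
  × Injective _≡_ _≡_ κ
  × (∀ i → x i ∈ A (κ i))
  × (∀ y → y ∈ X ⇔ ∃ λ i → x i ≡ y)

IsPresentation : Vector (Subset n) r → SetSystem n → Set
IsPresentation A M =
  (∀ i → A i ⊆ ground M) × (∀ X → Indep M X ⇔ IsPartialTransversal A X)

record Graph (v : ℕ) : Set₁ where
  field
    Adj    : Rel (Fin v) 0ℓ
    adj?   : Decidable Adj
    symm   : Symmetric Adj
    irrefl : Irreflexive _≡_ Adj

open Graph public

-- { x , y } = { a , b } as unordered pairs.
SameEdge : (x y a b : Fin v) → Set
SameEdge x y a b = (x ≡ a × y ≡ b) ⊎ (x ≡ b × y ≡ a)

deleteEdge : Graph v → Fin v → Fin v → Graph v
deleteEdge G a b = record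
  { Adj    = λ x y → Adj G x y × ¬ SameEdge x y a b
  ; adj?   = λ x y → adj? G x y ×-dec
               ¬? ((x Fin.≟ a ×-dec y Fin.≟ b) ⊎-dec (x Fin.≟ b ×-dec y Fin.≟ a))
  ; symm   = λ (xy , ≉) → symm G xy ,
               λ { (inj₁ (p , q)) → ≉ (inj₂ (q , p))
                 ; (inj₂ (p , q)) → ≉ (inj₁ (q , p)) }
  ; irrefl = λ x≡y (xy , _) → irrefl G x≡y xy
  }

-- The subgraph of G induced by W is nonempty and any two of its vertices
-- are joined by a walk staying inside W.
InducedConnected : Graph v → Pred (Fin v) 0ℓ → Set
InducedConnected G W =
    ∃ W
  × (∀ x y → W x → W y → Star (λ a b → W a × W b × Adj G a b) x y)

Connected : Graph v → Set
Connected G = InducedConnected G U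

-- A cycle of length 3 + m.
IsCycle : Graph v → {m : ℕ} → (Fin (3 + m) → Fin v) → Set
IsCycle G {m} c =
    Injective _≡_ _≡_ c
  × (∀ (i : Fin (2 + m)) → Adj G (c (inject₁ i)) (c (suc i)))
  × Adj G (c (fromℕ (2 + m))) (c zero)

IsTree : Graph v → Set
IsTree G = Connected G × (∀ m (c : Fin (3 + m) → _) → ¬ IsCycle G c)

module _ (M : SetSystem n) (e : Fin n) (A : Vector (Subset n) r) where

  record IsPresentingMap (G : Graph v) (φ : Fin v → Fin r) : Set where
    field
      injective : Injective _≡_ _≡_ φ
      image     : ∀ i → e ∈ A i ⇔ ∃ λ u → φ u ≡ i
      connected : ∀ v₁ v₂ → v₁ ≢ v₂ →
                  InducedConnected G λ u →
                    ∀ {x} → x ∈ A (φ u) → cl (M *) (A (φ v₁) ∪ A (φ v₂)) x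

  IsPresentingGraph : Graph v → Set
  IsPresentingGraph G = ∃ λ φ → IsPresentingMap G φ

  IsMinimalPresentingGraph : Graph v → Set
  IsMinimalPresentingGraph G =
      IsPresentingGraph G
    × (∀ a b → Adj G a b → ¬ IsPresentingGraph (deleteEdge G a b))

{-# OPTIONS --safe #-}
module Submission where

-- A set X ∪ e matched in A, with e matched to the vertex w, is turned into a
-- matching of X in the new family by rooting the tree at w and replacing each
-- other vertex by the edge towards its parent.
--
-- Conversely let X be matched in the new family.  If X ∪ e is not matched in A,
-- Hall's theorem gives Y ⊆ X ∪ e such that |Y| + |Q| > r, where Q indexes the
-- sets of A missing Y.  If the vertices in Q induce a connected subgraph (or
-- there are none), the edges of a spanning tree of it, together with the sets of
-- Q avoiding e, are missed by Y too, which contradicts the matching of X.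
-- Otherwise take v₁, v₂ in different components: as the graph is presenting,
-- some vertex s outside Q has A_s ⊆ cl*(A_v₁ ∪ A_v₂), so an element y of Y ∩ A_s
-- is a coloop of M \ (A_v₁ ∪ A_v₂), which contains Y.  Hence Y - y is dependent,
-- and it contains a smaller Y with the same property.

open import Defs
open import Data.Nat.Base using (ℕ; zero; suc; _+_; _∸_; _≤_; _<_; s≤s)
import Data.Nat.Properties as ℕ
open import Data.Fin.Base using (Fin; zero; suc; splitAt; punchIn; punchOut; _↑ˡ_; _↑ʳ_)
import Data.Fin.Properties as Fin
open import Data.Fin.Subset using (Subset; inside; outside; ⊤; _∈_; _∉_; _⊆_; _∪_; _─_; _-_; ⁅_⁆; ∣_∣; ⊥)
open import Data.Fin.Subset.Properties
open import Data.Vec.Base as Vec using ([]; _∷_; here; there)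
import Data.Vec.Properties as Vec
open import Data.Vec.Functional as F using (Vector; _++_)
import Data.Vec.Functional.Properties as F
open import Data.Product.Base using (∃; ∃₂; _×_; _,_; proj₁; proj₂)
open import Data.Sum.Base using (_⊎_; inj₁; inj₂; [_,_]′)
open import Data.Empty using () renaming (⊥ to False)
open import Function.Base using (_∘_; id; const)
open import Function.Bundles using (_⇔_; mk⇔; Equivalence)
open import Function.Definitions using (Injective)
open import Relation.Binary.Construct.Closure.ReflexiveTransitive using (Star; ε; _◅_)
open import Relation.Binary.Definitions using (Decidable)
open import Relation.Binary.PropositionalEquality using (_≡_; _≢_; refl; sym; trans; cong; subst)
open import Relation.Nullary using (¬_; yes; no; does; contradiction; ¬?; _×-dec_; decidable-stable)
open import Relation.Nullary.Decidable using (dec-true; dec-false)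
import Relation.Unary as Unary

private
  variable
    a b n r s : ℕ

-- Finite subsets and counting by injections.

Inj : {A B : Set} → (A → B) → Set
Inj = Injective _≡_ _≡_

comprehension : {P : Fin n → Set} → Unary.Decidable P → Subset n
comprehension P? = Vec.tabulate (does ∘ P?)

∈-comprehension⁺ : {P : Fin n → Set} (P? : Unary.Decidable P) → ∀ {x} → P x → x ∈ comprehension P?
∈-comprehension⁺ P? {x} px =
  Vec.lookup⇒[]= x _ (trans (Vec.lookup∘tabulate (does ∘ P?) x) (dec-true (P? x) px))

∈-comprehension⁻ : {P : Fin n → Set} (P? : Unary.Decidable P) → ∀ {x} → x ∈ comprehension P? → P x
∈-comprehension⁻ P? {x} x∈ = decidable-stable (P? x) λ ¬px →
  contradiction (trans (sym (trans (Vec.lookup∘tabulate (does ∘ P?) x) (dec-false (P? x) ¬px)))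
                       (Vec.[]=⇒lookup x∈)) λ ()

image : (Fin a → Fin n) → Subset n
image x = comprehension λ y → Fin.any? λ i → x i Fin.≟ y

∈-image⁺ : (x : Fin a → Fin n) → ∀ i → x i ∈ image x
∈-image⁺ x i = ∈-comprehension⁺ (λ y → Fin.any? λ i → x i Fin.≟ y) (i , refl)

∈-image⁻ : (x : Fin a → Fin n) → ∀ {y} → y ∈ image x → ∃ λ i → x i ≡ y
∈-image⁻ x = ∈-comprehension⁻ λ y → Fin.any? λ i → x i Fin.≟ y

x∈p─q⇒x∉q : ∀ {x} (p q : Subset n) → x ∈ p ─ q → x ∉ q
x∈p─q⇒x∉q (_ ∷ p) (inside ∷ q)  (there x∈) (there x∈q) = x∈p─q⇒x∉q p q x∈ x∈q
x∈p─q⇒x∉q (_ ∷ p) (outside ∷ q) (there x∈) (there x∈q) = x∈p─q⇒x∉q p q x∈ x∈q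

x∈p∪⁅y⁆⁻ : ∀ {x y} (p : Subset n) → x ∈ p ∪ ⁅ y ⁆ → x ∈ p ⊎ x ≡ y
x∈p∪⁅y⁆⁻ {y = y} p x∈ with x∈p∪q⁻ p ⁅ y ⁆ x∈
... | inj₁ x∈p = inj₁ x∈p
... | inj₂ x∈y = inj₂ (x∈⁅y⁆⇒x≡y y x∈y)

y∈p∪⁅y⁆ : ∀ {y} (p : Subset n) → y ∈ p ∪ ⁅ y ⁆
y∈p∪⁅y⁆ {y = y} p = q⊆p∪q p ⁅ y ⁆ (x∈⁅x⁆ y)

x∉p⇒∣p∣<∣p∪⁅x⁆∣ : ∀ {x} {p : Subset n} → x ∉ p → ∣ p ∣ < ∣ p ∪ ⁅ x ⁆ ∣
x∉p⇒∣p∣<∣p∪⁅x⁆∣ {x = x} {p} x∉p = p⊂q⇒∣p∣<∣q∣ (p⊆p∪q ⁅ x ⁆ , x , y∈p∪⁅y⁆ p , x∉p)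

record Enumeration (S : Subset n) : Set where
  field
    elem      : Fin ∣ S ∣ → Fin n
    injective : Inj elem
    elem∈     : ∀ i → elem i ∈ S
    index     : ∀ {x} → x ∈ S → ∃ λ i → elem i ≡ x

enumerate : (S : Subset n) → Enumeration S
enumerate [] = record { elem = λ () ; injective = λ {} ; elem∈ = λ () ; index = λ () }
enumerate (outside ∷ S) = record
  { elem      = suc ∘ elem
  ; injective = injective ∘ Fin.suc-injective
  ; elem∈     = there ∘ elem∈
  ; index     = λ { (there x∈) → let i , eq = index x∈ in i , cong suc eq }
  } where open Enumeration (enumerate S)
enumerate (inside ∷ S) = record
  { elem      = zero F.∷ suc ∘ elem
  ; injective = λ { {zero} {zero} _ → refl
                  ; {suc i} {suc j} eq → cong suc (injective (Fin.suc-injective eq)) }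
  ; elem∈     = λ { zero → here ; (suc i) → there (elem∈ i) }
  ; index     = λ { here → zero , refl
                  ; (there x∈) → let i , eq = index x∈ in suc i , cong suc eq }
  } where open Enumeration (enumerate S)

-- Every step that does not stop adds a new element, and a subset of `Fin n` has at most `n`
-- elements. In `go` the fuel `d` bounds the number of elements still outside `Z`.
saturate : (Inv Stop : Subset n → Set) →
           (∀ Z → Inv Z → Stop Z ⊎ ∃ λ x → x ∉ Z × Inv (Z ∪ ⁅ x ⁆)) →
           ∀ Z → Inv Z → ∃ λ Z → Inv Z × Stop Z
saturate {n} Inv Stop step Z inv = go n Z inv (ℕ.m≤m+n n ∣ Z ∣)
  where
  go : ∀ d Z → Inv Z → n ≤ d + ∣ Z ∣ → ∃ λ Z → Inv Z × Stop Z
  go d Z inv n≤ with step Z inv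
  ... | inj₁ stop = Z , inv , stop
  go zero Z inv n≤ | inj₂ (x , x∉Z , inv′) =
    contradiction (∣p∣≤n (Z ∪ ⁅ x ⁆)) (ℕ.<⇒≱ (ℕ.≤-<-trans n≤ (x∉p⇒∣p∣<∣p∪⁅x⁆∣ x∉Z)))
  go (suc d) Z inv n≤ | inj₂ (x , x∉Z , inv′) =
    go d (Z ∪ ⁅ x ⁆) inv′ (ℕ.≤-trans n≤ (ℕ.≤-trans (ℕ.≤-reflexive (sym (ℕ.+-suc d ∣ Z ∣)))
                                                 (ℕ.+-monoʳ-≤ d (x∉p⇒∣p∣<∣p∪⁅x⁆∣ x∉Z))))

disjoint-injections⇒≤ : (f : Fin a → Fin r) (g : Fin b → Fin r) → Inj f → Inj g →
                        (∀ i j → f i ≢ g j) → a + b ≤ r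
disjoint-injections⇒≤ {a} {r} {b} f g f-inj g-inj f≢g = Fin.injective⇒≤ {f = f ++ g} inj
  where
  inj : Inj (f ++ g)
  inj {i} {j} eq with splitAt a i in p | splitAt a j in q
  ... | inj₁ i′ | inj₁ j′ =
    trans (sym (Fin.splitAt⁻¹-↑ˡ p)) (trans (cong (_↑ˡ b) (f-inj eq)) (Fin.splitAt⁻¹-↑ˡ q))
  ... | inj₁ i′ | inj₂ j′ = contradiction eq (f≢g i′ j′)
  ... | inj₂ i′ | inj₁ j′ = contradiction (sym eq) (f≢g j′ i′)
  ... | inj₂ i′ | inj₂ j′ =
    trans (sym (Fin.splitAt⁻¹-↑ʳ p)) (trans (cong (a ↑ʳ_) (g-inj eq)) (Fin.splitAt⁻¹-↑ʳ q))

covering⇒≤ : (f : Fin a → Fin r) (g : Fin b → Fin r) →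
             (∀ j → (∃ λ i → f i ≡ j) ⊎ (∃ λ i → g i ≡ j)) → r ≤ a + b
covering⇒≤ {a} {r} {b} f g cover = Fin.injective⇒≤ inj
  where
  section : ∀ j → ∃ λ i → (f ++ g) i ≡ j
  section j with cover j
  ... | inj₁ (i , eq) = i ↑ˡ b , trans (F.lookup-++ˡ f g i) eq
  ... | inj₂ (i , eq) = a ↑ʳ i , trans (F.lookup-++ʳ f g i) eq
  inj : Inj (proj₁ ∘ section)
  inj {i} {j} eq = trans (sym (proj₂ (section i))) (trans (cong (f ++ g) eq) (proj₂ (section j)))

-- Matchings and Hall's theorem.

IsMatching : (Fin s → Fin r → Set) → (Fin s → Fin r) → Set
IsMatching R f = Inj f × (∀ i → R i (f i))

∷-matching : {R : Fin (suc s) → Fin r → Set} {f : Fin s → Fin r} {j : Fin r} →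
             IsMatching (R ∘ suc) f → R zero j → (∀ i → f i ≢ j) → IsMatching R (j F.∷ f)
∷-matching (f-inj , fR) Rj free =
  (λ { {zero}  {zero}  _  → refl
     ; {zero}  {suc i} eq → contradiction (sym eq) (free i)
     ; {suc i} {zero}  eq → contradiction eq (free i)
     ; {suc i} {suc k} eq → cong suc (f-inj eq) }) ,
  λ { zero → Rj ; (suc i) → fR i }

-- One switch along an alternating path: `z` moves to the free column `j` and gives up `f z`.
updateAt-matching : {R : Fin s → Fin r → Set} {f : Fin s → Fin r} {z : Fin s} {j : Fin r} →
                    IsMatching R f → R z j → (∀ i → f i ≢ j) →
                    IsMatching R (F.updateAt f z (const j))
updateAt-matching {s = s} {r} {R} {f} {z} {j} (f-inj , fR) Rzj free = inj , fR′
  where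
  f′ : Fin s → Fin r
  f′ = F.updateAt f z (const j)
  at : f′ z ≡ j
  at = F.updateAt-updates z f
  off : ∀ {i} → i ≢ z → f′ i ≡ f i
  off = F.updateAt-minimal _ z f
  inj : Inj f′
  inj {i} {k} eq with i Fin.≟ z | k Fin.≟ z
  ... | yes refl | yes refl = refl
  ... | yes refl | no k≢z   = contradiction (trans (sym (off k≢z)) (trans (sym eq) at)) (free k)
  ... | no i≢z   | yes refl = contradiction (trans (sym (off i≢z)) (trans eq at)) (free i)
  ... | no i≢z   | no k≢z   = f-inj (trans (sym (off i≢z)) (trans eq (off k≢z)))
  fR′ : ∀ i → R i (f′ i)
  fR′ i with i Fin.≟ z
  ... | yes refl = subst (R z) (sym at) Rzj
  ... | no i≢z   = subst (R i) (sym (off i≢z)) (fR i)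

-- A violation of Hall's condition: the neighbours of `rows` lie outside `columns`, so there are
-- fewer than `∣ rows ∣` of them.
record Obstruction (R : Fin s → Fin r → Set) : Set where
  field
    rows      : Subset s
    columns   : Subset r
    unrelated : ∀ {i j} → i ∈ rows → j ∈ columns → ¬ R i j
    large     : r < ∣ rows ∣ + ∣ columns ∣

-- König's form of Hall's theorem.  A matching f of the rows other than zero is
-- extended by growing a set Z of rows reachable from zero by alternating paths.
hall : (R : Fin s → Fin r → Set) → Decidable R → ∃ (IsMatching R) ⊎ Obstruction R
hall {zero}  R R? = inj₁ ((λ ()) , (λ {}) , λ ())
hall {suc s} {r} R R? with hall (R ∘ suc) (λ i → R? (suc i))
... | inj₂ obs = inj₂ record
  { rows      = outside ∷ rows
  ; columns   = columns
  ; unrelated = λ { (there i∈) j∈ → unrelated i∈ j∈ }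
  ; large     = large
  } where open Obstruction obs
... | inj₁ (f , fm) = finish (saturate Augmentable (λ Z → Augmented ⊎ Closed Z) step ⊥ start)
  where
  Augmented : Set
  Augmented = ∃ (IsMatching R)

  -- The quantification over g says that an alternating path from zero to z
  -- switches f only at rows in Z.
  Augmentable : Subset s → Set
  Augmentable Z = ∀ z → z ∈ inside ∷ Z →
    ∀ g → IsMatching (R ∘ suc) g → (∀ i → i ∈ Z → g i ≡ f i) →
    ∀ j → (∀ i → g i ≢ j) → R z j → Augmented

  Closed : Subset s → Set
  Closed Z = ∀ z j → z ∈ inside ∷ Z → R z j → ∃ λ i → i ∈ Z × f i ≡ j

  start : Augmentable ⊥
  start zero    _          g gm _ j free Rj = j F.∷ g , ∷-matching {R = R} gm Rj free
  start (suc z) (there z∈) = contradiction z∈ ∉⊥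

  -- If an alternating path ends at `z′` with a free column `j`, then `z′` moves to `j`. This frees
  -- `f z′`, which is a legitimate end for a path through `z`; rows in `Z` are untouched because
  -- `z′` is not in `Z`.
  extend : ∀ Z z z′ → z ∈ inside ∷ Z → z′ ∉ Z → R z (f z′) → Augmentable Z → Augmentable (Z ∪ ⁅ z′ ⁆)
  extend Z z z′ z∈ z′∉Z Rz aug y y∈ g gm g≗f j free Ryj = split y y∈ Ryj
    where
    old : ∀ x → x ∈ inside ∷ Z → R x j → Augmented
    old x x∈ = aug x x∈ g gm (λ i → g≗f i ∘ p⊆p∪q ⁅ z′ ⁆) j free

    new : R (suc z′) j → Augmented
    new Rj = aug z z∈ g′ (updateAt-matching {R = R ∘ suc} gm Rj free) g′≗f (f z′) free′ Rz
      where
      g′ : Fin s → Fin r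
      g′ = F.updateAt g z′ (const j)
      gz′ : g z′ ≡ f z′
      gz′ = g≗f z′ (y∈p∪⁅y⁆ Z)
      off : ∀ {i} → i ≢ z′ → g′ i ≡ g i
      off = F.updateAt-minimal _ z′ g
      g′≗f : ∀ i → i ∈ Z → g′ i ≡ f i
      g′≗f i i∈Z = trans (off λ { refl → z′∉Z i∈Z }) (g≗f i (p⊆p∪q ⁅ z′ ⁆ i∈Z))
      free′ : ∀ i → g′ i ≢ f z′
      free′ i eq with i Fin.≟ z′
      ... | yes refl = free i (trans gz′ (trans (sym eq) (F.updateAt-updates z′ g)))
      ... | no i≢z′  = i≢z′ (proj₁ gm (trans (sym (off i≢z′)) (trans eq (sym gz′))))

    split : ∀ x → x ∈ inside ∷ (Z ∪ ⁅ z′ ⁆) → R x j → Augmented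
    split zero    _          = old zero here
    split (suc x) (there x∈) with x∈p∪⁅y⁆⁻ Z x∈
    ... | inj₁ x∈Z  = old (suc x) (there x∈Z)
    ... | inj₂ refl = new

  step : ∀ Z → Augmentable Z → (Augmented ⊎ Closed Z) ⊎ ∃ λ x → x ∉ Z × Augmentable (Z ∪ ⁅ x ⁆)
  step Z aug
    with Fin.any? (λ z → z ∈? (inside ∷ Z) ×-dec
           Fin.any? λ j → R? z j ×-dec Fin.all? λ i → ¬? (f i Fin.≟ j))
       | Fin.any? (λ z′ → ¬? (z′ ∈? Z) ×-dec
           Fin.any? λ z → z ∈? (inside ∷ Z) ×-dec R? z (f z′))
  ... | yes (z , z∈ , j , Rzj , free) | _ =
    inj₁ (inj₁ (aug z z∈ f fm (λ _ _ → refl) j free Rzj))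
  ... | no _ | yes (z′ , z′∉Z , z , z∈ , Rz) = inj₂ (z′ , z′∉Z , extend Z z z′ z∈ z′∉Z Rz aug)
  ... | no ¬free | no ¬new = inj₁ (inj₂ closed)
    where
    closed : Closed Z
    closed z j z∈ Rzj with Fin.any? (λ i → f i Fin.≟ j)
    ... | no ¬i = contradiction (z , z∈ , j , Rzj , λ i eq → ¬i (i , eq)) ¬free
    ... | yes (i , refl) with i ∈? Z
    ...   | yes i∈Z = i , i∈Z , refl
    ...   | no i∉Z  = contradiction (i , i∉Z , z , z∈ , Rzj) ¬new

  finish : (∃ λ Z → Augmentable Z × (Augmented ⊎ Closed Z)) → Augmented ⊎ Obstruction R
  finish (_ , _ , inj₁ matching) = inj₁ matching
  finish (Z , _ , inj₂ closed) = inj₂ record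
    { rows      = inside ∷ Z
    ; columns   = comprehension free?
    ; unrelated = λ {i} i∈ j∈ Rij → ∈-comprehension⁻ free? j∈ (i , i∈ , Rij)
    -- Closedness makes every column either free or the image under `f` of a row in `Z`, so `r` is
    -- at most the size of `Z` plus the number of free columns. The row `zero` makes the inequality
    -- strict.
    ; large     = s≤s (covering⇒≤ (f ∘ Z.elem) Q.elem cover)
    }
    where
    free? : Unary.Decidable λ j → ¬ ∃ λ i → i ∈ inside ∷ Z × R i j
    free? j = ¬? (Fin.any? λ i → i ∈? (inside ∷ Z) ×-dec R? i j)
    module Z = Enumeration (enumerate Z)
    module Q = Enumeration (enumerate (comprehension free?))
    cover : ∀ j → (∃ λ i → f (Z.elem i) ≡ j) ⊎ (∃ λ i → Q.elem i ≡ j)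
    cover j with free? j
    ... | yes free = inj₂ (Q.index (∈-comprehension⁺ free? free))
    ... | no ¬free with decidable-stable (Fin.any? (λ i → i ∈? (inside ∷ Z) ×-dec R? i j)) ¬free
    ...   | z , z∈ , Rzj with closed z j z∈ Rzj
    ...     | i , i∈Z , refl = let i′ , eq = Z.index i∈Z in inj₁ (i′ , cong f eq)

-- Matchings into a family of sets, and partial transversals.

Matchable : Vector (Subset n) r → (Fin a → Fin n) → Set
Matchable A x = ∃ (IsMatching λ i j → x i ∈ A j)

missed? : (A : Vector (Subset n) r) (x : Fin a → Fin n) →
          Unary.Decidable λ j → ¬ ∃ λ i → x i ∈ A j
missed? A x j = ¬? (Fin.any? λ i → x i ∈? A j)

missed : Vector (Subset n) r → (Fin a → Fin n) → Subset r
missed A x = comprehension (missed? A x)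

-- Hall's condition fails for the whole of `x`: fewer than `a` of the `r` sets meet it.
Deficient : Vector (Subset n) r → (Fin a → Fin n) → Set
Deficient {r = r} {a = a} A x = r < a + ∣ missed A x ∣

matchable⊎deficient : (A : Vector (Subset n) r) (x : Fin s → Fin n) →
  Matchable A x ⊎ ∃₂ λ a (y : Fin a → Fin s) → Inj y × Deficient A (x ∘ y)
matchable⊎deficient A x with hall (λ i j → x i ∈ A j) (λ i j → x i ∈? A j)
... | inj₁ matching = inj₁ matching
... | inj₂ obs = inj₂ (_ , elem , injective ,
    -- The columns of the obstruction are among the sets missed by its rows, and passing to all
    -- missed sets only enlarges the count.
    ℕ.<-≤-trans large (ℕ.+-monoʳ-≤ ∣ rows ∣ (p⊆q⇒∣p∣≤∣q∣ λ j∈ →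
      ∈-comprehension⁺ (missed? A (x ∘ elem)) λ (i , xi∈) → unrelated (elem∈ i) j∈ xi∈)))
  where
  open Obstruction obs
  open Enumeration (enumerate rows)

matchable⇒¬deficient : (A : Vector (Subset n) r) (x : Fin a → Fin n) →
                       Matchable A x → ¬ Deficient A x
matchable⇒¬deficient A x (κ , κ-inj , x∈) = ℕ.≤⇒≯
  (disjoint-injections⇒≤ κ elem κ-inj injective λ i j eq →
    ∈-comprehension⁻ (missed? A x) (elem∈ j) (i , subst (λ l → x i ∈ A l) eq (x∈ i)))
  where open Enumeration (enumerate (missed A x))

matchable⇒partialTransversal : (A : Vector (Subset n) r) (x : Fin a → Fin n) → Inj x →
                               Matchable A x → IsPartialTransversal A (image x)
matchable⇒partialTransversal A x x-inj (κ , κ-inj , x∈) =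
  _ , x , κ , x-inj , κ-inj , x∈ ,
  λ y → mk⇔ (∈-image⁻ x) λ { (i , refl) → ∈-image⁺ x i }

partialTransversal⇒matchable : (A : Vector (Subset n) r) {X : Subset n} {x : Fin a → Fin n} →
                               IsPartialTransversal A X → Inj x → (∀ i → x i ∈ X) → Matchable A x
partialTransversal⇒matchable A {x = x} (_ , y , κ , y-inj , κ-inj , y∈ , X≗y) x-inj x∈X =
  κ ∘ ι ,
  (λ eq → x-inj (trans (sym (yι _)) (trans (cong y (κ-inj eq)) (yι _)))) ,
  λ i → subst (_∈ A (κ (ι i))) (yι i) (y∈ (ι i))
  where
  ι = λ i → proj₁ (Equivalence.to (X≗y (x i)) (x∈X i))
  yι : ∀ i → y (ι i) ≡ x i
  yι i = proj₂ (Equivalence.to (X≗y (x i)) (x∈X i))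

-- Bases, coindependence and dual closure.

extend-to-basis : {M : SetSystem n} → IsMatroid M → ∀ {B₀ I} → IsBasis M B₀ → Indep M I →
                  ∃ λ B → IsBasis M B × I ⊆ B × B ⊆ I ∪ B₀
extend-to-basis {n} {M} isM {B₀} {I} (_ , B₀-indep , B₀-max) I-indep =
  let B , (B-indep , I⊆B , B⊆) , B₀≤B = saturate Inv (λ Z → ∣ B₀ ∣ ≤ ∣ Z ∣) step I (I-indep , id , p⊆p∪q B₀)
  in B , (indep⊆ground B-indep , B-indep , maximal B₀≤B) , I⊆B , B⊆
  where
  open IsMatroid isM
  -- New elements come only from `B₀`, so that the resulting basis avoids every set disjoint from
  -- both `I` and `B₀`.
  Inv : Subset n → Set
  Inv Z = Indep M Z × I ⊆ Z × Z ⊆ I ∪ B₀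
  step : ∀ Z → Inv Z → ∣ B₀ ∣ ≤ ∣ Z ∣ ⊎ ∃ λ x → x ∉ Z × Inv (Z ∪ ⁅ x ⁆)
  step Z (Z-indep , I⊆Z , Z⊆) with ∣ B₀ ∣ ℕ.≤? ∣ Z ∣
  ... | yes B₀≤Z = inj₁ B₀≤Z
  ... | no B₀≰Z with augmentation Z-indep B₀-indep (ℕ.≰⇒> B₀≰Z)
  ...   | x , x∈B₀ , x∉Z , Zx-indep = inj₂ (x , x∉Z , Zx-indep , p⊆p∪q ⁅ x ⁆ ∘ I⊆Z , Zx⊆)
    where
    Zx⊆ : Z ∪ ⁅ x ⁆ ⊆ I ∪ B₀
    Zx⊆ y∈ with x∈p∪⁅y⁆⁻ Z y∈
    ... | inj₁ y∈Z  = Z⊆ y∈Z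
    ... | inj₂ refl = q⊆p∪q I B₀ x∈B₀
  -- A proper independent superset of `B` would be larger than `B₀` and so would augment it,
  -- although `B₀` is a basis.
  maximal : ∀ {B} → ∣ B₀ ∣ ≤ ∣ B ∣ → ∀ J → J ⊆ ground M → Indep M J → B ⊆ J → J ⊆ B
  maximal {B} B₀≤B J _ J-indep B⊆J {x} x∈J = decidable-stable (x ∈? B) λ x∉B →
    let y , _ , y∉B₀ , B₀y-indep = augmentation B₀-indep J-indep
                                     (ℕ.≤-<-trans B₀≤B (p⊂q⇒∣p∣<∣q∣ (B⊆J , x , x∈J , x∉B)))
    in y∉B₀ (B₀-max (B₀ ∪ ⁅ y ⁆) (indep⊆ground B₀y-indep) B₀y-indep (p⊆p∪q ⁅ y ⁆) (y∈p∪⁅y⁆ B₀))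

-- An element of cl*(Z) outside Z is a coloop of M \ Z.  Were I ∪ y dependent,
-- a basis containing I and avoiding a largest coindependent subset J of Z would
-- also avoid y, making J ∪ y coindependent.
cl*-coloop : {M : SetSystem n} → IsMatroid M → ∀ {Z y I} → cl (M *) Z y → y ∉ Z →
             Indep M I → (∀ {x} → x ∈ I → x ∉ Z) → ¬ ¬ Indep M (I ∪ ⁅ y ⁆)
cl*-coloop {M = M} isM {Z} {y} {I} (y∈E , _ , ((J , J⊆Z , (B₀ , B₀-basis , J⊆E─B₀) , refl) , _) , (_ , ≤k))
           y∉Z I-indep I∩Z Iy-dep =
  ℕ.<⇒≱ (x∉p⇒∣p∣<∣p∪⁅x⁆∣ (y∉Z ∘ J⊆Z)) (≤k (J ∪ ⁅ y ⁆) Jy⊆Zy (B , B-basis , Jy⊆E─B))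
  where
  open IsMatroid isM
  extended = extend-to-basis isM B₀-basis I-indep
  B = proj₁ extended
  B-basis = proj₁ (proj₂ extended)
  I⊆B : I ⊆ B
  I⊆B = proj₁ (proj₂ (proj₂ extended))
  B⊆ : B ⊆ I ∪ B₀
  B⊆ = proj₂ (proj₂ (proj₂ extended))
  Jy⊆Zy : J ∪ ⁅ y ⁆ ⊆ Z ∪ ⁅ y ⁆
  Jy⊆Zy x∈ with x∈p∪⁅y⁆⁻ J x∈
  ... | inj₁ x∈J  = p⊆p∪q ⁅ y ⁆ (J⊆Z x∈J)
  ... | inj₂ refl = y∈p∪⁅y⁆ Z
  Iy⊆B : y ∈ B → I ∪ ⁅ y ⁆ ⊆ B
  Iy⊆B y∈B x∈ with x∈p∪⁅y⁆⁻ I x∈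
  ... | inj₁ x∈I  = I⊆B x∈I
  ... | inj₂ refl = y∈B
  Jy⊆E─B : J ∪ ⁅ y ⁆ ⊆ ground M ─ B
  Jy⊆E─B {x} x∈ with x∈p∪⁅y⁆⁻ J x∈
  ... | inj₂ refl = x∈p∧x∉q⇒x∈p─q y∈E λ y∈B → Iy-dep (hereditary (Iy⊆B y∈B) (proj₁ (proj₂ B-basis)))
  ... | inj₁ x∈J = x∈p∧x∉q⇒x∈p─q (p─q⊆p (ground M) B₀ (J⊆E─B₀ x∈J)) x∉B
    where
    x∉B : x ∉ B
    x∉B x∈B with x∈p∪q⁻ I B₀ (B⊆ x∈B)
    ... | inj₁ x∈I  = I∩Z x∈I (J⊆Z x∈J)
    ... | inj₂ x∈B₀ = x∈p─q⇒x∉q (ground M) B₀ (J⊆E─B₀ x∈J) x∈B₀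

-- Independence is not assumed decidable, so a largest independent subset of `X` can be had only up
-- to double negation. If none exists, each independent subset gives way to a larger one, beyond the
-- bound `n`.
¬¬rank-exists : (N : SetSystem n) → Indep N ⊥ → ∀ X → ¬ ¬ ∃ (HasRank N X)
¬¬rank-exists {n} N ⊥-indep X no-rank = go n ⊥ ⊥⊆ ⊥-indep (ℕ.m≤m+n n ∣ ⊥ {n = n} ∣)
  where
  go : ∀ d I → I ⊆ X → Indep N I → n ≤ d + ∣ I ∣ → False
  go zero I I⊆X I-indep n≤I = no-rank (_ , (I , I⊆X , I-indep , refl) , λ J _ _ → ℕ.≤-trans (∣p∣≤n J) n≤I)
  go (suc d) I I⊆X I-indep n≤ = no-rank (_ , (I , I⊆X , I-indep , refl) , λ J J⊆X J-indep →
    decidable-stable (_ ℕ.≤? _) λ J≰I → go d J J⊆X J-indep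
      (ℕ.≤-trans n≤ (ℕ.≤-trans (ℕ.≤-reflexive (sym (ℕ.+-suc d ∣ I ∣))) (ℕ.+-monoʳ-≤ d (ℕ.≰⇒> J≰I)))))

⊆-cl : (N : SetSystem n) {Z : Subset n} → ∃ (HasRank N Z) → ∀ {x} → x ∈ ground N → x ∈ Z → cl N Z x
⊆-cl N {Z} (k , rank) {x} x∈E x∈Z = x∈E , k , rank , subst (λ Y → HasRank N Y k) (⊆-antisym (p⊆p∪q ⁅ x ⁆) Zx⊆Z) rank
  where
  Zx⊆Z : Z ∪ ⁅ x ⁆ ⊆ Z
  Zx⊆Z y∈ with x∈p∪⁅y⁆⁻ Z y∈
  ... | inj₁ y∈Z  = y∈Z
  ... | inj₂ refl = x∈Z

-- Walks and spanning trees.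

exits : {T : Fin n → Fin n → Set} (Z : Subset n) → ∀ {x y} → Star T x y → x ∈ Z → y ∉ Z →
        ∃₂ λ a b → a ∈ Z × b ∉ Z × T a b
exits Z ε x∈ x∉ = contradiction x∈ x∉
exits Z (_◅_ {j = b} Txb walk) x∈ y∉ with b ∈? Z
... | yes b∈ = exits Z walk b∈ y∉
... | no b∉  = _ , b , x∈ , b∉ , Txb

module _ {p l : ℕ} (G : Graph p) (u v : Vector (Fin p) l)
         (edges : ∀ x y → Adj G x y ⇔ ∃ λ i → SameEdge x y (u i) (v i)) where

  -- child is a left inverse of the map sending a vertex other than the root to
  -- the edge towards its parent; its values on the other edges are irrelevant.
  record RootedTree (w : Fin p) (Z : Subset p) : Set where
    field
      root   : w ∈ Z
      child  : Fin l → Fin p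
      parent : ∀ {z} → z ∈ Z → z ≢ w →
               ∃ λ i → child i ≡ z × u i ∈ Z × v i ∈ Z × (z ≡ u i ⊎ z ≡ v i)

  -- The edge `i` joining `a` and `b` becomes the parent edge of `b`. Overwriting `child` at `i` is
  -- harmless, because the earlier parent edges have both ends in `Z`, whereas `b` lies outside.
  attach-leaf : ∀ {w Z a b} → RootedTree w Z → a ∈ Z → b ∉ Z → Adj G a b → RootedTree w (Z ∪ ⁅ b ⁆)
  attach-leaf {w} {Z} {a} {b} tree a∈ b∉ ab = attach (Equivalence.to (edges a b) ab)
    where
    open RootedTree tree
    grow : Z ⊆ Z ∪ ⁅ b ⁆
    grow = p⊆p∪q ⁅ b ⁆
    b∈ : b ∈ Z ∪ ⁅ b ⁆
    b∈ = y∈p∪⁅y⁆ Z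
    attach : (∃ λ i → SameEdge a b (u i) (v i)) → RootedTree w (Z ∪ ⁅ b ⁆)
    attach (i , same) = record
      { root   = grow root
      ; child  = F.updateAt child i (const b)
      ; parent = parent′
      }
      where
      old≢i : ∀ {j} → u j ∈ Z → v j ∈ Z → j ≢ i
      old≢i u∈ v∈ refl = [ (λ (_ , b≡v) → b∉ (subst (_∈ Z) (sym b≡v) v∈))
                         , (λ (_ , b≡u) → b∉ (subst (_∈ Z) (sym b≡u) u∈)) ]′ same
      new-ends : SameEdge a b (u i) (v i) → u i ∈ Z ∪ ⁅ b ⁆ × v i ∈ Z ∪ ⁅ b ⁆ × (b ≡ u i ⊎ b ≡ v i)
      new-ends (inj₁ (refl , refl)) = grow a∈ , b∈ , inj₂ refl
      new-ends (inj₂ (refl , refl)) = b∈ , grow a∈ , inj₁ refl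
      parent′ : ∀ {z} → z ∈ Z ∪ ⁅ b ⁆ → z ≢ w →
                ∃ λ j → F.updateAt child i (const b) j ≡ z ×
                        u j ∈ Z ∪ ⁅ b ⁆ × v j ∈ Z ∪ ⁅ b ⁆ × (z ≡ u j ⊎ z ≡ v j)
      parent′ z∈ z≢w with x∈p∪⁅y⁆⁻ Z z∈
      ... | inj₁ z∈Z = let j , cj , u∈ , v∈ , end = parent z∈Z z≢w in
        j , trans (F.updateAt-minimal j i child (old≢i u∈ v∈)) cj , grow u∈ , grow v∈ , end
      ... | inj₂ refl = i , F.updateAt-updates i child , new-ends same

  -- Leaves are attached to `w` until no edge leads to a further vertex of `Q`; then `Z` is the
  -- component of `w` in the subgraph induced by `Q`.
  spanning-tree : (Q : Subset p) → ∀ {w} → w ∈ Q →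
    ∃ λ Z → RootedTree w Z × Z ⊆ Q × (∀ {a b} → a ∈ Z → b ∈ Q → Adj G a b → b ∈ Z)
  spanning-tree Q {w} w∈Q =
    let Z , (tree , Z⊆Q) , closed = saturate Inv Closed step ⁅ w ⁆ start
    in Z , tree , Z⊆Q , closed
    where
    Inv Closed : Subset p → Set
    Inv Z = RootedTree w Z × Z ⊆ Q
    Closed Z = ∀ {a b} → a ∈ Z → b ∈ Q → Adj G a b → b ∈ Z
    start : Inv ⁅ w ⁆
    start = record
      { root   = x∈⁅x⁆ w
      ; child  = const w
      ; parent = λ z∈ z≢w → contradiction (x∈⁅y⁆⇒x≡y w z∈) z≢w
      } , λ z∈ → subst (_∈ Q) (sym (x∈⁅y⁆⇒x≡y w z∈)) w∈Q
    step : ∀ Z → Inv Z → Closed Z ⊎ ∃ λ b → b ∉ Z × Inv (Z ∪ ⁅ b ⁆)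
    step Z (tree , Z⊆Q)
      with Fin.any? (λ b → ¬? (b ∈? Z) ×-dec b ∈? Q ×-dec Fin.any? λ a → a ∈? Z ×-dec adj? G a b)
    ... | no ¬b = inj₁ λ {a} {b} a∈ b∈Q ab →
      decidable-stable (b ∈? Z) λ b∉ → ¬b (b , b∉ , b∈Q , a , a∈ , ab)
    ... | yes (b , b∉ , b∈Q , a , a∈ , ab) = inj₂ (b , b∉ , attach-leaf tree a∈ b∉ ab , ⊆Q)
      where
      ⊆Q : Z ∪ ⁅ b ⁆ ⊆ Q
      ⊆Q z∈ with x∈p∪⁅y⁆⁻ Z z∈
      ... | inj₁ z∈Z  = Z⊆Q z∈Z
      ... | inj₂ refl = b∈Q

-- An independent set of size equal to the rank is a basis, and its complement contains the empty
-- set.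
∅-coindep : {M : SetSystem n} → HasRank M (ground M) r → Indep (M *) ⊥
∅-coindep {M = M} ((B , B⊆E , B-indep , refl) , ≤r) = B , (B⊆E , B-indep , maximal) , ⊥⊆
  where
  maximal : ∀ I → I ⊆ ground M → Indep M I → B ⊆ I → I ⊆ B
  maximal I I⊆E I-indep B⊆I {x} x∈I = decidable-stable (x ∈? B) λ x∉B →
    ℕ.<⇒≱ (p⊂q⇒∣p∣<∣q∣ (B⊆I , x , x∈I , x∉B)) (≤r I I⊆E I-indep)

-- The contracted family and the contraction of `e`.

module Contraction
         {n : ℕ} (M : SetSystem n) (isM : IsMatroid M) (e : Fin n) (k m : ℕ)
         (A : Vector (Subset n) (suc k + m)) (pres : IsPresentation A M)
         (rank : HasRank M (ground M) (suc k + m))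
         (e∈A : ∀ i → e ∈ A (i ↑ˡ m)) (e∉A : ∀ j → e ∉ A (suc k ↑ʳ j))
         {p : ℕ} (G : Graph p) (connected : Connected G)
         (φ : Fin p → Fin (suc k + m)) (isMap : IsPresentingMap M e A G φ)
         (u v : Vector (Fin p) k)
         (edges : ∀ x y → Adj G x y ⇔ ∃ λ i → SameEdge x y (u i) (v i)) where

  private module Map = IsPresentingMap isMap

  -- Here `k` counts the edges of the graph, one fewer than the sets containing `e`.
  edgeSet : Vector (Subset n) k
  edgeSet i = (A (φ (u i)) ∪ A (φ (v i))) - e

  otherSet : Vector (Subset n) m
  otherSet j = A (suc k ↑ʳ j)

  contracted : Vector (Subset n) (k + m)
  contracted = edgeSet ++ otherSet

  e∈Aφ : ∀ z → e ∈ A (φ z)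
  e∈Aφ z = Equivalence.from (Map.image (φ z)) (z , refl)

  vertex⊎other : ∀ j → (∃ λ z → φ z ≡ j) ⊎ (∃ λ b → suc k ↑ʳ b ≡ j)
  vertex⊎other j with splitAt (suc k) j in eq
  ... | inj₁ i = inj₁ (Equivalence.to (Map.image j) (subst (λ l → e ∈ A l) (Fin.splitAt⁻¹-↑ˡ eq) (e∈A i)))
  ... | inj₂ b = inj₂ (b , Fin.splitAt⁻¹-↑ʳ eq)

  ∈edgeSet⁻ : ∀ {x i} → x ∈ edgeSet i → x ∈ A (φ (u i)) ⊎ x ∈ A (φ (v i))
  ∈edgeSet⁻ {i = i} x∈ = x∈p∪q⁻ (A (φ (u i))) (A (φ (v i))) (p─q⊆p _ ⁅ e ⁆ x∈)

  ∈contracted-edge : ∀ {x} i → x ∈ contracted (i ↑ˡ m) → x ∈ edgeSet i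
  ∈contracted-edge {x} i = subst (x ∈_) (F.lookup-++ˡ edgeSet otherSet i)

  ∈contracted-other : ∀ {x} j → x ∈ contracted (k ↑ʳ j) → x ∈ otherSet j
  ∈contracted-other {x} j = subst (x ∈_) (F.lookup-++ʳ edgeSet otherSet j)

  contracted⊆E-e : ∀ l → contracted l ⊆ ground M ─ ⁅ e ⁆
  contracted⊆E-e l {x} x∈ with splitAt k l
  ... | inj₂ j = x∈p∧x≢y⇒x∈p-y (proj₁ pres _ x∈) λ { refl → e∉A j x∈ }
  ... | inj₁ i with ∈edgeSet⁻ {i = i} x∈
  ...   | inj₁ x∈u = x∈p∧x∉q⇒x∈p─q (proj₁ pres _ x∈u) (x∈p─q⇒x∉q _ ⁅ e ⁆ x∈)
  ...   | inj₂ x∈v = x∈p∧x∉q⇒x∈p─q (proj₁ pres _ x∈v) (x∈p─q⇒x∉q _ ⁅ e ⁆ x∈)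

  e∉contracted : ∀ l → e ∉ contracted l
  e∉contracted l e∈ = x∈p─q⇒x∉q (ground M) ⁅ e ⁆ (contracted⊆E-e l e∈) (x∈⁅x⁆ e)

  -- As `e` is not a loop, the basis of `⁅ e ⁆` occurring in the definition of `M / ⁅ e ⁆` has to be
  -- `⁅ e ⁆` itself.
  singleton-indep : Indep M ⁅ e ⁆
  singleton-indep = Equivalence.from (proj₂ pres ⁅ e ⁆)
    (1 , const e , const zero , (λ { {zero} {zero} _ → refl }) , (λ { {zero} {zero} _ → refl }) ,
     const (e∈A zero) ,
     λ y → mk⇔ (λ y∈ → zero , sym (x∈⁅y⁆⇒x≡y e y∈)) λ { (_ , refl) → x∈⁅x⁆ e })

  -- From M / e to the contracted family: root the tree at the vertex whose set
  -- is matched to e, and move every other vertex to the edge towards its parent.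
  indep⇒contracted : ∀ X → Indep (M / ⁅ e ⁆) X → IsPartialTransversal contracted X
  indep⇒contracted X (X⊆E-e , B , (B⊆e , _ , B-max) , XB-indep) =
    reindex (Equivalence.to (proj₂ pres (X ∪ B)) XB-indep)
    where
    e∈B : e ∈ B
    e∈B = B-max ⁅ e ⁆ id singleton-indep B⊆e (x∈⁅x⁆ e)

    reindex : IsPartialTransversal A (X ∪ B) → IsPartialTransversal contracted X
    reindex (t , x , κ , x-inj , κ-inj , x∈ , XB≗x) with Equivalence.to (XB≗x e) (q⊆p∪q X B e∈B)
    reindex (suc t , x , κ , x-inj , κ-inj , x∈ , XB≗x) | i₀ , refl
      with Equivalence.to (Map.image (κ i₀)) (x∈ i₀)
    ... | w , φw≡ = t , x ∘ punchIn i₀ , κ′ , Fin.punchIn-injective i₀ _ _ ∘ x-inj , κ′-inj , x∈′ , X≗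
      where
      tree = spanning-tree G u v edges ⊤ (∈⊤ {x = w})
      Z = proj₁ tree
      open RootedTree (proj₁ (proj₂ tree))

      all∈Z : ∀ z → z ∈ Z
      all∈Z z = decidable-stable (z ∈? Z) λ z∉ →
        let a , b , a∈ , b∉ , _ , _ , ab = exits Z (proj₂ connected w z _ _) root z∉
        in b∉ (proj₂ (proj₂ (proj₂ tree)) a∈ ∈⊤ ab)

      -- `old` leads from a new index back to the index of `A` that was moved there; this left
      -- inverse gives the injectivity of `κ′`.
      old : Fin (k + m) → Fin (suc k + m)
      old = (φ ∘ child) ++ (suc k ↑ʳ_)

      slot : ∀ j → j ≢ κ i₀ → ∃ λ l → old l ≡ j × (∀ {y} → y ∈ A j → y ≢ e → y ∈ contracted l)
      slot j j≢ with vertex⊎other j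
      ... | inj₂ (b , refl) =
        k ↑ʳ b , F.lookup-++ʳ (φ ∘ child) (suc k ↑ʳ_) b ,
        λ {y} y∈ _ → subst (y ∈_) (sym (F.lookup-++ʳ edgeSet otherSet b)) y∈
      ... | inj₁ (z , refl) with parent (all∈Z z) (λ { refl → j≢ φw≡ })
      ...   | i , refl , _ , _ , end =
        i ↑ˡ m , F.lookup-++ˡ (φ ∘ child) (suc k ↑ʳ_) i ,
        λ {y} y∈ y≢e → subst (y ∈_) (sym (F.lookup-++ˡ edgeSet otherSet i))
          (x∈p∧x≢y⇒x∈p-y (x∈p∪q⁺ ([ (λ eq → inj₁ (subst (λ z → y ∈ A (φ z)) eq y∈))
                                  , (λ eq → inj₂ (subst (λ z → y ∈ A (φ z)) eq y∈)) ]′ end)) y≢e)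

      slotAt : ∀ i → _
      slotAt i = slot (κ (punchIn i₀ i)) λ eq → Fin.punchInᵢ≢i i₀ i (κ-inj eq)

      κ′ : Fin t → Fin (k + m)
      κ′ i = proj₁ (slotAt i)

      κ′-inj : Inj κ′
      κ′-inj {i} {j} eq = Fin.punchIn-injective i₀ i j (κ-inj
        (trans (sym (proj₁ (proj₂ (slotAt i)))) (trans (cong old eq) (proj₁ (proj₂ (slotAt j))))))

      x∈′ : ∀ i → x (punchIn i₀ i) ∈ contracted (κ′ i)
      x∈′ i = proj₂ (proj₂ (slotAt i)) (x∈ _) λ eq → Fin.punchInᵢ≢i i₀ i (x-inj eq)

      X≗ : ∀ y → y ∈ X ⇔ ∃ λ i → x (punchIn i₀ i) ≡ y
      X≗ y = mk⇔ to from
        where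
        to : y ∈ X → ∃ λ i → x (punchIn i₀ i) ≡ y
        to y∈X with Equivalence.to (XB≗x y) (p⊆p∪q B y∈X)
        ... | i , refl = punchOut i₀≢i , cong x (Fin.punchIn-punchOut i₀≢i)
          where
          i₀≢i : i₀ ≢ i
          i₀≢i refl = x∈p─q⇒x∉q (ground M) ⁅ e ⁆ (X⊆E-e y∈X) (x∈⁅x⁆ e)
        from : (∃ λ i → x (punchIn i₀ i) ≡ y) → y ∈ X
        from (i , refl) with x∈p∪q⁻ X B (Equivalence.from (XB≗x y) (_ , refl))
        ... | inj₁ y∈X = y∈X
        ... | inj₂ y∈B = contradiction (x-inj (x∈⁅y⁆⇒x≡y e (B⊆e y∈B))) (Fin.punchInᵢ≢i i₀ i)

  -- From the contracted family to `M / ⁅ e ⁆`.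

  module _ {t : ℕ} (x : Fin t → Fin n) (κ : Fin t → Fin (k + m)) (x-inj : Inj x) (κ-inj : Inj κ)
           (x∈ : ∀ i → x i ∈ contracted (κ i)) where

    x⁺ : Fin (suc t) → Fin n
    x⁺ = e F.∷ x

    x⁺-inj : Inj x⁺
    x⁺-inj {zero}  {zero}  _  = refl
    x⁺-inj {zero}  {suc i} eq = contradiction (subst (_∈ contracted (κ i)) (sym eq) (x∈ i)) (e∉contracted (κ i))
    x⁺-inj {suc i} {zero}  eq = contradiction (subst (_∈ contracted (κ i)) eq (x∈ i)) (e∉contracted (κ i))
    x⁺-inj {suc i} {suc j} eq = cong suc (x-inj eq)

    -- The extra set `⁅ e ⁆` receives `e`, so that `x⁺` is matched in a family with as many sets as
    -- `A` and the two counts can be compared directly.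
    A⁺ : Vector (Subset n) (suc (k + m))
    A⁺ = ⁅ e ⁆ F.∷ contracted

    A⁺-matching : IsMatching (λ i l → x⁺ i ∈ A⁺ l) (zero F.∷ suc ∘ κ)
    A⁺-matching =
      (λ { {zero} {zero} _ → refl ; {suc i} {suc j} eq → cong suc (κ-inj (Fin.suc-injective eq)) }) ,
      λ { zero → x∈⁅x⁆ e ; (suc i) → x∈ i }

    module _ {a : ℕ} (y : Fin a → Fin (suc t)) (y-inj : Inj y) (deficient : Deficient A (x⁺ ∘ y)) where

      private
        Q : Subset (suc k + m)
        Q = missed A (x⁺ ∘ y)
        module Q = Enumeration (enumerate Q)

        avoids : ∀ {j} → j ∈ Q → ∀ i → x⁺ (y i) ∉ A j
        avoids j∈ i yi∈ = ∈-comprehension⁻ (missed? A (x⁺ ∘ y)) j∈ (i , yi∈)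

      -- Injecting the missed sets into members of A⁺ missed as well shows that
      -- y has no deficiency, since y is matched in A⁺.
      no-slots : (old : Fin (suc (k + m)) → Fin (suc k + m)) →
                 ¬ (∀ j → j ∈ Q → ∃ λ l → old l ≡ j × (∀ i → x⁺ (y i) ∉ A⁺ l))
      no-slots old slot = ℕ.<⇒≱ deficient
        (disjoint-injections⇒≤ ((zero F.∷ suc ∘ κ) ∘ y) (proj₁ ∘ slotAt) (y-inj ∘ proj₁ A⁺-matching)
          (λ {i} {j} eq → Q.injective (trans (sym (proj₁ (proj₂ (slotAt i))))
                                              (trans (cong old eq) (proj₁ (proj₂ (slotAt j))))))
          λ i j eq → proj₂ (proj₂ (slotAt j)) i
                       (subst (λ l → x⁺ (y i) ∈ A⁺ l) eq (proj₂ A⁺-matching (y i))))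
        where
        slotAt : ∀ i → _
        slotAt i = slot (Q.elem i) (Q.elem∈ i)

      other-slot : ∀ b → suc k ↑ʳ b ∈ Q → ∀ i → x⁺ (y i) ∉ A⁺ (suc (k ↑ʳ b))
      other-slot b b∈ i = avoids b∈ i ∘ ∈contracted-other b

      -- By `cl*-coloop`, the element `x⁺ (y i)` is then a coloop once the sets of `v₁` and `v₂`,
      -- which `y` avoids, are deleted.
      Separated : Set
      Separated = ∃₂ λ v₁ v₂ → φ v₁ ∈ Q × φ v₂ ∈ Q ×
                  ∃ λ i → cl (M *) (A (φ v₁) ∪ A (φ v₂)) (x⁺ (y i))

      -- If the missed vertices are absent or form a single component, counting refutes the
      -- deficiency. The double negation comes from `¬¬rank-exists`, needed to place the two
      -- vertices themselves in the subgraph that is known to be connected.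
      separated : ¬ ¬ Separated
      separated ¬sep with Fin.any? (λ w → φ w ∈? Q)
      -- Every missed set avoids `e` here, so it also occurs in `A⁺`, at the same index.
      ... | no ¬w = no-slots id slot
        where
        slot : ∀ j → j ∈ Q → ∃ λ l → l ≡ j × (∀ i → x⁺ (y i) ∉ A⁺ l)
        slot j j∈ with vertex⊎other j
        ... | inj₁ (w , refl) = contradiction (w , j∈) ¬w
        ... | inj₂ (b , refl) = suc (k ↑ʳ b) , refl , other-slot b j∈
      ... | yes (w , w∈Q)
        with spanning-tree G u v edges (comprehension λ z → φ z ∈? Q) (∈-comprehension⁺ (λ z → φ z ∈? Q) w∈Q)
      ...   | Z , tree , Z⊆Q , closed with Fin.any? (λ z → φ z ∈? Q ×-dec ¬? (z ∈? Z))
      ...     | no spans = no-slots old slot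
        where
        open RootedTree tree
        -- The root `w` has no parent edge and takes the slot of `⁅ e ⁆`. That slot is missed too,
        -- since `e` lies in the missed set `A (φ w)` and so is not among the elements picked by
        -- `y`.
        old : Fin (suc (k + m)) → Fin (suc k + m)
        old = φ w F.∷ ((φ ∘ child) ++ (suc k ↑ʳ_))
        φ∈Q : ∀ {z} → z ∈ Z → φ z ∈ Q
        φ∈Q = ∈-comprehension⁻ (λ z → φ z ∈? Q) ∘ Z⊆Q
        slot : ∀ j → j ∈ Q → ∃ λ l → old l ≡ j × (∀ i → x⁺ (y i) ∉ A⁺ l)
        slot j j∈ with vertex⊎other j
        ... | inj₂ (b , refl) = suc (k ↑ʳ b) , F.lookup-++ʳ (φ ∘ child) (suc k ↑ʳ_) b , other-slot b j∈
        ... | inj₁ (z , refl) with z Fin.≟ w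
        ...   | yes refl = zero , refl , λ i yi∈ →
          avoids w∈Q i (subst (_∈ A (φ w)) (sym (x∈⁅y⁆⇒x≡y e yi∈)) (e∈Aφ w))
        ...   | no z≢w with parent (decidable-stable (z ∈? Z) λ z∉ → spans (z , j∈ , z∉)) z≢w
        ...     | i , refl , u∈ , v∈ , _ =
          suc (i ↑ˡ m) , F.lookup-++ˡ (φ ∘ child) (suc k ↑ʳ_) i ,
          λ i′ yi∈ → [ avoids (φ∈Q u∈) i′ , avoids (φ∈Q v∈) i′ ]′ (∈edgeSet⁻ {i = i} (∈contracted-edge i yi∈))
      ...     | yes (z , z∈Q , z∉Z) =
        ¬¬rank-exists (M *) (∅-coindep rank) (A (φ w) ∪ A (φ z)) λ rk →
        -- A walk from `w` to `z` within the dual closure leaves the component `Z` at some `b`. As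
        -- `Z` is closed under edges inside `Q`, the set of `b` is not missed, and an element of `y`
        -- in it lies in the dual closure.
        let a , b , a∈ , b∉ , _ , Wb , ab = exits Z
              (proj₂ (Map.connected w z λ { refl → z∉Z root }) w z
                (λ x∈w → ⊆-cl (M *) rk (proj₁ pres _ x∈w) (p⊆p∪q (A (φ z)) x∈w))
                (λ x∈z → ⊆-cl (M *) rk (proj₁ pres _ x∈z) (q⊆p∪q (A (φ w)) (A (φ z)) x∈z)))
              root z∉Z
            i , yi∈ = decidable-stable (Fin.any? λ i → x⁺ (y i) ∈? A (φ b)) λ ¬i →
              b∉ (closed a∈ (∈-comprehension⁺ (λ z → φ z ∈? Q) (∈-comprehension⁺ (missed? A (x⁺ ∘ y)) ¬i)) ab)
        in ¬sep (w , z , w∈Q , z∈Q , i , Wb yi∈)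
        where open RootedTree tree

      avoids-pair : ∀ {v₁ v₂} → φ v₁ ∈ Q → φ v₂ ∈ Q → ∀ i → x⁺ (y i) ∉ A (φ v₁) ∪ A (φ v₂)
      avoids-pair v₁∈ v₂∈ i yi∈ = [ avoids v₁∈ i , avoids v₂∈ i ]′ (x∈p∪q⁻ _ _ yi∈)

    -- Induction on the bound `N` for the number of elements. Hall's theorem is applied to `y`
    -- without the coloop: a matching would extend to all of `y`, against its deficiency, and
    -- otherwise a deficient family with fewer elements appears.
    ¬deficient : ∀ N {a} (y : Fin a → Fin (suc t)) → a ≤ N → Inj y → ¬ Deficient A (x⁺ ∘ y)
    ¬deficient N y a≤N y-inj def = separated y y-inj def (reduce N y a≤N y-inj def)
      where
      reduce : ∀ N {a} (y : Fin a → Fin (suc t)) → a ≤ N → (y-inj : Inj y) (def : Deficient A (x⁺ ∘ y)) →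
               ¬ Separated y y-inj def
      reduce (suc N) {suc a} y (s≤s a≤N) y-inj def (v₁ , v₂ , v₁∈ , v₂∈ , i , yi∈cl)
        with matchable⊎deficient A (x⁺ ∘ y ∘ punchIn i)
      ... | inj₂ (_ , y′ , y′-inj , def′) =
        ¬deficient N (y ∘ punchIn i ∘ y′) (ℕ.≤-trans (Fin.injective⇒≤ y′-inj) a≤N)
          (y′-inj ∘ Fin.punchIn-injective i _ _ ∘ y-inj) def′
      ... | inj₁ matching =
        cl*-coloop isM yi∈cl (avoids-pair y y-inj def v₁∈ v₂∈ i)
          (Equivalence.from (proj₂ pres (image rest))
            (matchable⇒partialTransversal A rest (Fin.punchIn-injective i _ _ ∘ y-inj ∘ x⁺-inj) matching))
          disjoint
          λ indep → matchable⇒¬deficient A (x⁺ ∘ y)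
            (partialTransversal⇒matchable A (Equivalence.to (proj₂ pres _) indep) (y-inj ∘ x⁺-inj) all∈) def
        where
        rest : Fin a → Fin n
        rest = x⁺ ∘ y ∘ punchIn i
        disjoint : ∀ {z} → z ∈ image rest → z ∉ A (φ v₁) ∪ A (φ v₂)
        disjoint z∈ with ∈-image⁻ rest z∈
        ... | j , refl = avoids-pair y y-inj def v₁∈ v₂∈ (punchIn i j)
        all∈ : ∀ j → x⁺ (y j) ∈ image rest ∪ ⁅ x⁺ (y i) ⁆
        all∈ j with i Fin.≟ j
        ... | yes refl = y∈p∪⁅y⁆ (image rest)
        ... | no i≢j   = p⊆p∪q _ (subst (λ j → x⁺ (y j) ∈ image rest) (Fin.punchIn-punchOut i≢j)
                                   (∈-image⁺ rest (punchOut i≢j)))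

    matchable : Matchable A x⁺
    matchable with matchable⊎deficient A x⁺
    ... | inj₁ matching = matching
    ... | inj₂ (a , y , y-inj , def) = contradiction def (¬deficient a y ℕ.≤-refl y-inj)

  contracted⇒indep : ∀ X → IsPartialTransversal contracted X → Indep (M / ⁅ e ⁆) X
  contracted⇒indep X (t , x , κ , x-inj , κ-inj , x∈ , X≗x) =
    X⊆E-e , ⁅ e ⁆ , (id , singleton-indep , λ _ I⊆e _ _ → I⊆e) ,
    subst (Indep M) (⊆-antisym image⊆ ⊆image)
      (Equivalence.from (proj₂ pres _)
        (matchable⇒partialTransversal A _ (x⁺-inj x κ x-inj κ-inj x∈) (matchable x κ x-inj κ-inj x∈)))
    where
    X⊆E-e : X ⊆ ground M ─ ⁅ e ⁆
    X⊆E-e {z} z∈ with Equivalence.to (X≗x z) z∈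
    ... | i , refl = contracted⊆E-e (κ i) (x∈ i)
    image⊆ : image (e F.∷ x) ⊆ X ∪ ⁅ e ⁆
    image⊆ {z} z∈ with ∈-image⁻ (e F.∷ x) z∈
    ... | zero  , refl = y∈p∪⁅y⁆ X
    ... | suc i , refl = p⊆p∪q ⁅ e ⁆ (Equivalence.from (X≗x z) (i , refl))
    ⊆image : X ∪ ⁅ e ⁆ ⊆ image (e F.∷ x)
    ⊆image {z} z∈ with x∈p∪⁅y⁆⁻ X z∈
    ... | inj₂ refl = ∈-image⁺ (e F.∷ x) zero
    ... | inj₁ z∈X with Equivalence.to (X≗x z) z∈X
    ...   | i , refl = ∈-image⁺ (e F.∷ x) (suc i)

theorem1p2 : ∀ {n : ℕ} (M : SetSystem n) → IsMatroid M →
    ∀ (e : Fin n) → e ∈ ground M →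
    -- r = k + m
    ∀ (k m : ℕ) (A : Vector (Subset n) (k + m)) →
    IsPresentation A M → HasRank M (ground M) (k + m) →
    (∀ (i : Fin k) → e ∈ A (i ↑ˡ m)) →
    (∀ (j : Fin m) → e ∉ A (k ↑ʳ j)) →
    ∀ {p : ℕ} (G : Graph p) → IsMinimalPresentingGraph M e A G → IsTree G →
    ∀ (φ : Fin p → Fin (k + m)) → IsPresentingMap M e A G φ →
    ∀ (u v : Vector (Fin p) (k ∸ 1)) →
    (∀ x y → Adj G x y ⇔ ∃ λ i → SameEdge x y (u i) (v i)) →
    IsPresentation
    ((λ i → (A (φ (u i)) ∪ A (φ (v i))) - e) ++ (λ j → A (k ↑ʳ j)))
    (M / ⁅ e ⁆)
-- No set contains `e` in this case, yet the connected graph has a vertex `z`, and `A (φ z)` must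
-- contain `e`.
theorem1p2 M isM e _ zero m A pres rank _ e∉A G _ (((z , _) , _) , _) φ isMap u v edges =
  contradiction (Equivalence.from (IsPresentingMap.image isMap (φ z)) (z , refl)) (e∉A (φ z))
theorem1p2 M isM e _ (suc k) m A pres rank e∈A e∉A G _ (connected , _) φ isMap u v edges =
  contracted⊆E-e , λ X → mk⇔ (indep⇒contracted X) (contracted⇒indep X)
  where open Contraction M isM e k m A pres rank e∈A e∉A G connected φ isMap u v edges
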